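{- Let $G=(V,E)$ be a bipartite graph with $m=|E|$ edges and $B$ butterflies. Let $e$ be an edge chosen uniformly at random from $E$ and let $Y=B_e\cdot\frac m4$ (the return value of one iteration of the algorithm ESamp). Then $\mathbb{E}[Y]=B$.
   Context: Graphs are finite, simple, bipartite. A butterfly is a $2\times2$ biclique (two vertices on each side of the bipartition, all four edges between them present). $B=B(G)$ is the number of butterflies in $G$ and $B_e$ is the number of butterflies containing the edge $e$. -}

module Defs where

open import Level using (0ℓ)
open import Data.Nat using (ℕ; NonZero)
open import Data.Integer using (+_)
open import Data.Rational using (ℚ; 0ℚ; _+_; _*_; _/_)
open import Data.Fin using (Fin; _<_)
open import Data.Fin.Properties using (_≟_; _<?_)
open import Data.List
  using (List; map; foldr; filter; length; allFin; cartesianProduct)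
open import Data.Product using (_×_; _,_)
open import Data.Sum using (_⊎_)
open import Relation.Nullary using (yes; no; _×-dec_; _⊎-dec_)
open import Relation.Unary using () renaming (Decidable to Decidable₁)
open import Relation.Binary using (Rel; Symmetric; Irreflexive; Decidable; DecidableEquality)
open import Relation.Binary.PropositionalEquality using (_≡_; _≢_; refl)

record SimpleGraph : Set₁ where
  field
    order    : ℕ
  Vertex : Set
  Vertex = Fin order
  field
    _~_      : Rel Vertex 0ℓ
    ~-sym    : Symmetric _~_
    ~-irrefl : Irreflexive _≡_ _~_
    _~?_     : Decidable _~_

data Side : Set where
  left right : Side

_≟ˢ_ : DecidableEquality Side
left  ≟ˢ left  = yes refl
left  ≟ˢ right = no λ ()
right ≟ˢ left  = no λ ()
right ≟ˢ right = yes refl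

record BipartiteGraph : Set₁ where
  field
    graph : SimpleGraph
  open SimpleGraph graph public
  field
    side    : Vertex → Side
    ~⇒side≢ : ∀ {u v} → u ~ v → side u ≢ side v

module _ (G : BipartiteGraph) where
  open BipartiteGraph G

  vertexPairs : List (Vertex × Vertex)
  vertexPairs = cartesianProduct (allFin order) (allFin order)

  -- Every edge has exactly one endpoint on each side, so listing the left
  -- endpoint first represents each unordered edge by exactly one pair.
  IsEdge : Vertex × Vertex → Set
  IsEdge (u , v) = side u ≡ left × side v ≡ right × u ~ v

  isEdge? : Decidable₁ IsEdge
  isEdge? (u , v) = (side u ≟ˢ left) ×-dec (side v ≟ˢ right) ×-dec (u ~? v)

  edges : List (Vertex × Vertex)
  edges = filter isEdge? vertexPairs

  #edges : ℕ
  #edges = length edges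

  -- The 2-element vertex sets {u, u′} and {v, v′} are represented by their
  -- increasing enumerations, so each butterfly is counted exactly once.
  IsButterfly : (Vertex × Vertex) × (Vertex × Vertex) → Set
  IsButterfly ((u , u′) , (v , v′)) =
    u < u′ × v < v′ ×
    IsEdge (u , v) × IsEdge (u , v′) × IsEdge (u′ , v) × IsEdge (u′ , v′)

  isButterfly? : Decidable₁ IsButterfly
  isButterfly? ((u , u′) , (v , v′)) =
    (u <? u′) ×-dec (v <? v′) ×-dec
    isEdge? (u , v) ×-dec isEdge? (u , v′) ×-dec
    isEdge? (u′ , v) ×-dec isEdge? (u′ , v′)

  butterflies : List ((Vertex × Vertex) × (Vertex × Vertex))
  butterflies = filter isButterfly? (cartesianProduct vertexPairs vertexPairs)

  #butterflies : ℕ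
  #butterflies = length butterflies

  Contains : Vertex × Vertex → (Vertex × Vertex) × (Vertex × Vertex) → Set
  Contains (x , y) ((u , u′) , (v , v′)) =
    (x ≡ u ⊎ x ≡ u′) × (y ≡ v ⊎ y ≡ v′)

  contains? : ∀ e → Decidable₁ (Contains e)
  contains? (x , y) ((u , u′) , (v , v′)) =
    ((x ≟ u) ⊎-dec (x ≟ u′)) ×-dec ((y ≟ v) ⊎-dec (y ≟ v′))

  #butterfliesAt : Vertex × Vertex → ℕ
  #butterfliesAt e = length (filter (contains? e) butterflies)

ℕ→ℚ : ℕ → ℚ
ℕ→ℚ k = + k / 1

-- A finitely supported distribution: outcomes paired with their probabilities.
Distribution : Set → Set
Distribution A = List (A × ℚ)

uniform : {A : Set} (xs : List A) .{{_ : NonZero (length xs)}} → Distribution A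
uniform xs = map (λ x → x , + 1 / length xs) xs

𝔼 : {A : Set} → Distribution A → (A → ℚ) → ℚ
𝔼 d Y = foldr _+_ 0ℚ (map (λ (x , p) → p * Y x) d)

-- The value returned by one iteration of ESamp when it samples the edge e.
eSamp : (G : BipartiteGraph) → let open BipartiteGraph G in Vertex × Vertex → ℚ
eSamp G e = ℕ→ℚ (#butterfliesAt G e) * (+ #edges G / 4)

{-# OPTIONS --safe #-}

-- Each butterfly contains exactly four edges, so counting the incident pairs
-- (edge, butterfly) in two ways gives Σₑ Bₑ = 4 B.  The factors 1/m, m/4 and 4
-- then cancel in 𝔼[Y] = Σₑ (1/m) · (Bₑ · m/4).
module Submission where

open import Defs
open import Data.Fin.Properties using (<⇒≢)
open import Data.Integer as ℤ using (+_)
import Data.Integer.Properties as ℤ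
open import Data.List
  using (List; []; _∷_; map; filter; length; allFin; cartesianProduct)
open import Data.List.Membership.Propositional using (_∈_)
open import Data.List.Membership.Propositional.Properties
  using (∈-filter⁺; ∈-filter⁻; ∈-allFin; ∈-cartesianProduct⁺; ∈-cartesianProduct⁻)
open import Data.List.Membership.Propositional.Properties.WithK using (unique∧set⇒bag)
open import Data.List.Relation.Binary.BagAndSetEquality using (∼bag⇒↭)
open import Data.List.Relation.Binary.Permutation.Propositional.Properties using (↭-length)
open import Data.List.Relation.Unary.All using (All; []; _∷_; tabulate)
open import Data.List.Relation.Unary.AllPairs using ([]; _∷_)
open import Data.List.Relation.Unary.Any using (here; there)
open import Data.List.Relation.Unary.Unique.Propositional using (Unique)
open import Data.List.Relation.Unary.Unique.Propositional.Properties
  using (filter⁺; cartesianProduct⁺; allFin⁺)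
open import Data.Nat as ℕ using (ℕ; suc; NonZero)
open import Data.Nat.ListAction using (sum)
import Data.Nat.Properties as ℕ
open import Algebra.Properties.CommutativeSemigroup ℕ.+-commutativeSemigroup
  using (x∙yz≈y∙xz)
open import Data.Product using (_,_; proj₂)
open import Data.Rational using (ℚ; _+_; _*_; _/_; fromℚᵘ)
open import Data.Rational.Properties
  using ( *-zeroˡ; *-zeroʳ; *-distribˡ-+; *-distribʳ-+; toℚᵘ-injective
        ; toℚᵘ-fromℚᵘ; toℚᵘ-homo-+; toℚᵘ-homo-*; fromℚᵘ-cong)
open import Data.Rational.Unnormalised as ℚᵘ using (mkℚᵘ; *≡*)
import Data.Rational.Unnormalised.Properties as ℚᵘ
open import Data.Sum using (_⊎_; inj₁; inj₂)
open import Function using (_⇔_; mk⇔)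
open import Level using (0ℓ)
open import Relation.Binary using (REL; Decidable)
open import Relation.Binary.PropositionalEquality
  using (_≡_; refl; sym; trans; cong; cong₂; module ≡-Reasoning)
open import Relation.Nullary using (yes; no)

-- `fromℚᵘ` inherits this from `toℚᵘ`, its inverse up to `≃`. It lets identities in `ℚ` be checked
-- on unnormalised fractions, where no gcd is in the way.
fromℚᵘ-homo-+ : ∀ p q → fromℚᵘ (p ℚᵘ.+ q) ≡ fromℚᵘ p + fromℚᵘ q
fromℚᵘ-homo-+ p q = toℚᵘ-injective (ℚᵘ.≃-trans (toℚᵘ-fromℚᵘ (p ℚᵘ.+ q))
  (ℚᵘ.≃-sym (ℚᵘ.≃-trans (toℚᵘ-homo-+ (fromℚᵘ p) (fromℚᵘ q))
    (ℚᵘ.+-cong (toℚᵘ-fromℚᵘ p) (toℚᵘ-fromℚᵘ q)))))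

fromℚᵘ-homo-* : ∀ p q → fromℚᵘ (p ℚᵘ.* q) ≡ fromℚᵘ p * fromℚᵘ q
fromℚᵘ-homo-* p q = toℚᵘ-injective (ℚᵘ.≃-trans (toℚᵘ-fromℚᵘ (p ℚᵘ.* q))
  (ℚᵘ.≃-sym (ℚᵘ.≃-trans (toℚᵘ-homo-* (fromℚᵘ p) (fromℚᵘ q))
    (ℚᵘ.*-cong (toℚᵘ-fromℚᵘ p) (toℚᵘ-fromℚᵘ q)))))

ℕ→ℚ-homo-+ : ∀ a b → ℕ→ℚ (a ℕ.+ b) ≡ ℕ→ℚ a + ℕ→ℚ b
ℕ→ℚ-homo-+ a b = trans
  -- Unnormalised addition cross-multiplies, so the numerator of `a/1 + b/1` is `a * 1 + b * 1`.
  (cong (_/ 1) (sym (cong₂ ℤ._+_ (ℤ.*-identityʳ (+ a)) (ℤ.*-identityʳ (+ b)))))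
  (fromℚᵘ-homo-+ (mkℚᵘ (+ a) 0) (mkℚᵘ (+ b) 0))

-- With `m` in the form `suc k`, every factor is `fromℚᵘ` of an explicit fraction, and a single
-- integer cross-multiplication remains.
1/m*[4b*m/4]≡b : ∀ m .{{_ : NonZero m}} b →
                 + 1 / m * (ℕ→ℚ (b ℕ.* 4) * (+ m / 4)) ≡ ℕ→ℚ b
1/m*[4b*m/4]≡b m@(suc k) b = begin
  fromℚᵘ 1/m * (fromℚᵘ 4b * fromℚᵘ m/4) ≡⟨ cong (fromℚᵘ 1/m *_) (fromℚᵘ-homo-* 4b m/4) ⟨
  fromℚᵘ 1/m * fromℚᵘ (4b ℚᵘ.* m/4)     ≡⟨ fromℚᵘ-homo-* 1/m (4b ℚᵘ.* m/4) ⟨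
  fromℚᵘ (1/m ℚᵘ.* (4b ℚᵘ.* m/4))       ≡⟨ fromℚᵘ-cong {1/m ℚᵘ.* (4b ℚᵘ.* m/4)} {mkℚᵘ (+ b) 0} (*≡* cross-multiplied) ⟩
  ℕ→ℚ b                                 ∎
  where
  open ≡-Reasoning
  -- `mkℚᵘ` stores the denominator minus one: `k`, `0` and `3` stand for `m`, `1` and `4`.
  1/m = mkℚᵘ (+ 1) k
  4b  = mkℚᵘ (+ (b ℕ.* 4)) 0
  m/4 = mkℚᵘ (+ m) 3

  cross-multiplied : (+ 1 ℤ.* (+ (b ℕ.* 4) ℤ.* + m)) ℤ.* + 1 ≡ + b ℤ.* + (m ℕ.* 4)
  cross-multiplied = begin
    (+ 1 ℤ.* (+ (b ℕ.* 4) ℤ.* + m)) ℤ.* + 1 ≡⟨ ℤ.*-identityʳ _ ⟩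
    + 1 ℤ.* (+ (b ℕ.* 4) ℤ.* + m)           ≡⟨ ℤ.*-identityˡ _ ⟩
    + (b ℕ.* 4) ℤ.* + m                     ≡⟨ ℤ.pos-* (b ℕ.* 4) m ⟨
    + (b ℕ.* 4 ℕ.* m)                       ≡⟨ cong +_ (ℕ.*-assoc b 4 m) ⟩
    + (b ℕ.* (4 ℕ.* m))                     ≡⟨ cong (λ n → + (b ℕ.* n)) (ℕ.*-comm 4 m) ⟩
    + (b ℕ.* (m ℕ.* 4))                     ≡⟨ ℤ.pos-* b (m ℕ.* 4) ⟩
    + b ℤ.* + (m ℕ.* 4)                     ∎

-- Linearity of expectation: both constants leave the sum, so the remaining counting takes place in
-- `ℕ`.
𝔼-constant-weight : ∀ {A : Set} (p c : ℚ) (f : A → ℕ) xs →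
  𝔼 (map (_, p) xs) (λ x → ℕ→ℚ (f x) * c) ≡ p * (ℕ→ℚ (sum (map f xs)) * c)
𝔼-constant-weight p c f []       = sym (trans (cong (p *_) (*-zeroˡ c)) (*-zeroʳ p))
𝔼-constant-weight p c f (x ∷ xs) = begin
  p * (ℕ→ℚ (f x) * c) + 𝔼 (map (_, p) xs) (λ y → ℕ→ℚ (f y) * c)
    ≡⟨ cong (λ q → p * (ℕ→ℚ (f x) * c) + q) (𝔼-constant-weight p c f xs) ⟩
  p * (ℕ→ℚ (f x) * c) + p * (ℕ→ℚ s * c)
    ≡⟨ *-distribˡ-+ p (ℕ→ℚ (f x) * c) (ℕ→ℚ s * c) ⟨
  p * (ℕ→ℚ (f x) * c + ℕ→ℚ s * c)
    ≡⟨ cong (p *_) (*-distribʳ-+ c (ℕ→ℚ (f x)) (ℕ→ℚ s)) ⟨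
  p * ((ℕ→ℚ (f x) + ℕ→ℚ s) * c)
    ≡⟨ cong (λ q → p * (q * c)) (ℕ→ℚ-homo-+ (f x) s) ⟨
  p * (ℕ→ℚ (f x ℕ.+ s) * c) ∎
  where
  open ≡-Reasoning
  s = sum (map f xs)

sum-map-constant : ∀ {A : Set} {f : A → ℕ} {k xs} →
                   All (λ x → f x ≡ k) xs → sum (map f xs) ≡ length xs ℕ.* k
sum-map-constant []           = refl
sum-map-constant (fx≡k ∷ all) = cong₂ ℕ._+_ fx≡k (sum-map-constant all)

module _ {A B : Set} {R : REL A B 0ℓ} (R? : Decidable R) where

  private
    row : List B → A → ℕ
    row ys x = length (filter (R? x) ys)

    column : List A → B → ℕ
    column xs y = length (filter (λ x → R? x y) xs)

  -- In the incidence matrix of `R`, a new row for `x` raises the column of `y` by one exactly when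
  -- `R x y` holds, and these increments add up to the row count of `x`.
  sum-column-∷ : ∀ x xs ys →
    sum (map (column (x ∷ xs)) ys) ≡ row ys x ℕ.+ sum (map (column xs) ys)
  sum-column-∷ x xs []       = refl
  sum-column-∷ x xs (y ∷ ys) with R? x y
  ... | yes _ = cong suc (trans (cong (column xs y ℕ.+_) (sum-column-∷ x xs ys))
                                (x∙yz≈y∙xz (column xs y) (row ys x) _))
  ... | no  _ = trans (cong (column xs y ℕ.+_) (sum-column-∷ x xs ys))
                      (x∙yz≈y∙xz (column xs y) (row ys x) _)

  double-counting : ∀ xs ys → sum (map (row ys) xs) ≡ sum (map (column xs) ys)
  -- In a matrix without rows every column count computes to 0.
  double-counting []       ys = sym (trans
    (sum-map-constant {k = 0} (tabulate {xs = ys} λ _ → refl)) (ℕ.*-zeroʳ (length ys)))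
  double-counting (x ∷ xs) ys = trans
    (cong (row ys x ℕ.+_) (double-counting xs ys)) (sym (sum-column-∷ x xs ys))

-- Without repetitions, equality as sets is equality as bags, so the lists are permutations of each
-- other.
unique∧set⇒length≡ : ∀ {A : Set} {xs ys : List A} → Unique xs → Unique ys →
                     (∀ {x} → x ∈ xs ⇔ x ∈ ys) → length xs ≡ length ys
unique∧set⇒length≡ xs! ys! xs∼ys = ↭-length (∼bag⇒↭ (unique∧set⇒bag xs! ys! xs∼ys))

∈-pair⁺ : ∀ {A : Set} {x a b : A} → x ≡ a ⊎ x ≡ b → x ∈ a ∷ b ∷ []
∈-pair⁺ (inj₁ x≡a) = here x≡a
∈-pair⁺ (inj₂ x≡b) = there (here x≡b)

∈-pair⁻ : ∀ {A : Set} {x a b : A} → x ∈ a ∷ b ∷ [] → x ≡ a ⊎ x ≡ b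
∈-pair⁻ (here x≡a)         = inj₁ x≡a
∈-pair⁻ (there (here x≡b)) = inj₂ x≡b

module _ (G : BipartiteGraph) where
  open BipartiteGraph G

  edges-unique : Unique (edges G)
  edges-unique = filter⁺ (isEdge? G) (cartesianProduct⁺ (allFin⁺ order) (allFin⁺ order))

  ∈-edges⁺ : ∀ {e} → IsEdge G e → e ∈ edges G
  ∈-edges⁺ {u , v} = ∈-filter⁺ (isEdge? G) (∈-cartesianProduct⁺ (∈-allFin u) (∈-allFin v))

  -- `Contains` only compares endpoints; adjacency comes from the biclique, whose four edges match
  -- the four choices of endpoints.
  contained⇒edge : ∀ {e b} → IsButterfly G b → Contains G e b → IsEdge G e
  contained⇒edge (_ , _ , uv , _    , _    , _)     (inj₁ refl , inj₁ refl) = uv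
  contained⇒edge (_ , _ , _  , uv′  , _    , _)     (inj₁ refl , inj₂ refl) = uv′
  contained⇒edge (_ , _ , _  , _    , u′v  , _)     (inj₂ refl , inj₁ refl) = u′v
  contained⇒edge (_ , _ , _  , _    , _    , u′v′)  (inj₂ refl , inj₂ refl) = u′v′

  -- The filtered list has the same members as the product of `u ∷ u′ ∷ []` and `v ∷ v′ ∷ []`, whose
  -- length computes to 4.
  #edgesOf-butterfly : ∀ {b} → IsButterfly G b →
    length (filter (λ e → contains? G e b) (edges G)) ≡ 4
  #edgesOf-butterfly {b@((u , u′) , (v , v′))} isB@(u<u′ , v<v′ , _) =
    unique∧set⇒length≡ (filter⁺ contained? edges-unique)
      -- The strict orderings in `IsButterfly` make the two vertices on each side distinct, so the
      -- four pairs do not repeat.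
      (cartesianProduct⁺ ((<⇒≢ u<u′ ∷ []) ∷ [] ∷ []) ((<⇒≢ v<v′ ∷ []) ∷ [] ∷ []))
      (mk⇔ to from)
    where
    contained? = λ e → contains? G e b
    us = u ∷ u′ ∷ []
    vs = v ∷ v′ ∷ []

    to : ∀ {e} → e ∈ filter contained? (edges G) → e ∈ cartesianProduct us vs
    to e∈ with _ , x∈ , y∈ ← ∈-filter⁻ contained? {xs = edges G} e∈ =
      ∈-cartesianProduct⁺ (∈-pair⁺ x∈) (∈-pair⁺ y∈)

    from : ∀ {e} → e ∈ cartesianProduct us vs → e ∈ filter contained? (edges G)
    from e∈ with x∈ , y∈ ← ∈-cartesianProduct⁻ us vs e∈ =
      ∈-filter⁺ contained? (∈-edges⁺ (contained⇒edge isB e∈b)) e∈b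
      where e∈b = ∈-pair⁻ x∈ , ∈-pair⁻ y∈

  sum-#butterfliesAt : sum (map (#butterfliesAt G) (edges G)) ≡ #butterflies G ℕ.* 4
  sum-#butterfliesAt = trans
    (double-counting (contains? G) (edges G) (butterflies G))
    -- After the exchange of summation, each butterfly contributes a column count of 4.
    (sum-map-constant (tabulate λ b∈ → #edgesOf-butterfly
      (proj₂ (∈-filter⁻ (isButterfly? G)
        {xs = cartesianProduct (vertexPairs G) (vertexPairs G)} b∈))))

lemma6 : (G : BipartiteGraph) .{{_ : NonZero (#edges G)}} →
    𝔼 (uniform (edges G)) (eSamp G) ≡ ℕ→ℚ (#butterflies G)
lemma6 G = begin
  𝔼 (uniform (edges G)) (eSamp G)
    -- By definition `uniform` gives every edge the weight `1/m`, and `eSamp` is an edge's butterfly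
    -- count times the constant `m/4`.
    ≡⟨ 𝔼-constant-weight (+ 1 / m) (+ m / 4) (#butterfliesAt G) (edges G) ⟩
  + 1 / m * (ℕ→ℚ (sum (map (#butterfliesAt G) (edges G))) * (+ m / 4))
    ≡⟨ cong (λ s → + 1 / m * (ℕ→ℚ s * (+ m / 4))) (sum-#butterfliesAt G) ⟩
  + 1 / m * (ℕ→ℚ (#butterflies G ℕ.* 4) * (+ m / 4))
    ≡⟨ 1/m*[4b*m/4]≡b m (#butterflies G) ⟩
  ℕ→ℚ (#butterflies G) ∎
  where
  open ≡-Reasoning
  m = #edges G
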